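{- Let $G$ be a finite simple graph, let $e$ be an edge of $G$, and let $G_e$ be a graph obtained from $G$ by subdividing $e$ at least once (i.e. by replacing $e$ with a path of any length at least $2$). Then $G_e$ is semi-transitively orientable if and only if $G\setminus e$ is semi-transitively orientable.
   Context: Graphs are finite, undirected and simple. An orientation of a graph assigns to each edge one of its two directions; it is acyclic if it has no directed cycle. A digraph is transitive if whenever $v_1\to v_2$ and $v_2\to v_3$ are directed edges on three distinct vertices, $v_1\to v_3$ is also a directed edge. Given an acyclic orientation $\phi$ of a graph $G$, a shortcut in $\phi(G)$ is a non-transitive induced subdigraph of $\phi(G)$ on a vertex set $\{v_1,\dots,v_n\}$ with $n\ge 4$ (distinct vertices) that contains the directed path $v_1\to v_2\to\cdots\to v_n$ and the directed edge $v_1\to v_n$. An acyclic orientation $\phi$ is semi-transitive if $\phi(G)$ contains no shortcut, and a graph is semi-transitively orientable if it has a semi-transitive orientation. $G\setminus e$ denotes $G$ with the edge $e$ deleted (keeping all vertices). Subdividing $e=xy$ at least once means deleting $e$ and adding a path $x,p_1,\dots,p_t,y$ with $t\ge 1$, where $p_1,\dots,p_t$ are new vertices. -}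

module Defs where

open import Data.Nat.Base using (ℕ; zero; suc; _+_)
open import Data.Nat.Properties using (1+n≢n) renaming (_≟_ to _≟ℕ_)
open import Data.Fin.Base using (Fin; zero; suc; toℕ; fromℕ; inject₁)
open import Data.Fin.Properties using (+↔⊎) renaming (_≟_ to _≟F_)
open import Data.Empty using (⊥)
open import Data.Product.Base using (Σ-syntax; _×_; _,_)
open import Data.Sum.Base using (_⊎_; inj₁; inj₂)
import Data.Sum.Base as Sum
open import Data.Sum.Function.Propositional using (_⊎-↔_)
open import Function.Base using (_on_; _∘_)
open import Function.Bundles using (_↔_)
open import Function.Definitions using (Injective)
open import Function.Construct.Composition using (_↔-∘_)
open import Function.Construct.Identity using (↔-id)
open import Function.Construct.Symmetry using (↔-sym)
open import Function.Properties.Inverse using (↔⇒↣)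
open import Level using (0ℓ)
open import Relation.Binary.Core using (Rel)
open import Relation.Binary.Definitions
  using (Decidable; DecidableEquality; Symmetric; Irreflexive; Asymmetric)
open import Relation.Binary.PropositionalEquality as ≡ using (_≡_; _≢_; refl)
open import Relation.Nullary.Negation.Core using (¬_)
open import Relation.Nullary.Decidable
  using (no; via-injection; _×-dec_; _⊎-dec_; ¬?)

record Graph : Set₁ where
  field
    Vertex : Set
    order  : ℕ
    finite : Vertex ↔ Fin order
    Adj    : Rel Vertex 0ℓ
    adj?   : Decidable Adj
    sym    : Symmetric Adj
    irrefl : Irreflexive _≡_ Adj

  _≟_ : DecidableEquality Vertex
  _≟_ = via-injection (↔⇒↣ finite) _≟F_

-- The edge {x , y}, with its two ends listed in some order.
record Edge (G : Graph) : Set where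
  open Graph G
  field
    x y : Vertex
    adj : Adj x y

------------------------------------------------------------------------
-- Digraphs, given by their arc relation

TransitiveDigraph : {V : Set} → Rel V 0ℓ → Set
TransitiveDigraph _⟶_ = ∀ {u v w} → u ≢ v → v ≢ w → u ≢ w →
                        u ⟶ v → v ⟶ w → u ⟶ w

module _ {V : Set} (_⟶_ : Rel V 0ℓ) where

  -- v 0 ⟶ v 1 ⟶ ⋯ ⟶ v k is a directed path on k + 1 distinct vertices.
  record IsDirectedPath {k : ℕ} (v : Fin (suc k) → V) : Set where
    field
      distinct : Injective _≡_ _≡_ v
      steps    : ∀ (i : Fin k) → v (inject₁ i) ⟶ v (suc i)

  record DirectedCycle : Set where
    field
      {k}    : ℕ
      v      : Fin (suc k) → V
      path   : IsDirectedPath v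
      closes : v (fromℕ k) ⟶ v zero

  -- Since v is injective, _⟶_ on v is (isomorphic to) the subdigraph
  -- induced on the set of the vertices v i.
  record Shortcut : Set where
    field
      {m}           : ℕ
      v             : Fin (4 + m) → V
      path          : IsDirectedPath v
      shortcutting  : v zero ⟶ v (fromℕ (3 + m))
      nontransitive : ¬ TransitiveDigraph (_⟶_ on v)

------------------------------------------------------------------------
-- Orientations

record Orientation (G : Graph) : Set₁ where
  open Graph G
  field
    Arc     : Rel Vertex 0ℓ
    arc⇒adj : ∀ {u v} → Arc u v → Adj u v
    orient  : ∀ {u v} → Adj u v → Arc u v ⊎ Arc v u
    asym    : Asymmetric Arc

module _ {G : Graph} (φ : Orientation G) where
  open Orientation φ

  Acyclic : Set
  Acyclic = ¬ DirectedCycle Arc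

  SemiTransitive : Set
  SemiTransitive = Acyclic × ¬ Shortcut Arc

SemiTransitivelyOrientable : Graph → Set₁
SemiTransitivelyOrientable G = Σ[ φ ∈ Orientation G ] SemiTransitive φ

------------------------------------------------------------------------
-- Deleting and subdividing an edge

module _ (G : Graph) (e : Edge G) where
  open Graph G
  open Edge e using (x; y)

  IsE : Rel Vertex 0ℓ
  IsE u v = (u ≡ x × v ≡ y) ⊎ (u ≡ y × v ≡ x)

  private
    isE? : Decidable IsE
    isE? u v = ((u ≟ x) ×-dec (v ≟ y)) ⊎-dec ((u ≟ y) ×-dec (v ≟ x))

    swapE : ∀ {u v} → IsE u v → IsE v u
    swapE (inj₁ (p , q)) = inj₂ (q , p)
    swapE (inj₂ (p , q)) = inj₁ (q , p)

  _∖_ : Graph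
  _∖_ = record
    { Vertex = Vertex
    ; order  = order
    ; finite = finite
    ; Adj    = λ u v → Adj u v × ¬ IsE u v
    ; adj?   = λ u v → adj? u v ×-dec ¬? (isE? u v)
    ; sym    = λ (a , ne) → sym a , ne ∘ swapE
    ; irrefl = λ u≡v (a , _) → irrefl u≡v a
    }

  module _ (t : ℕ) where

    SubdividedVertex : Set
    SubdividedVertex = Vertex ⊎ Fin t

    pattern old u = inj₁ u
    pattern new i = inj₂ i

    -- a and b are consecutive, in this order, on the path
    -- x , new 0 , … , new (t ∸ 1) , y.
    Next : Rel SubdividedVertex 0ℓ
    Next (old u) (old v) = ⊥
    Next (old u) (new j) = u ≡ x × toℕ j ≡ 0
    Next (new i) (old v) = suc (toℕ i) ≡ t × v ≡ y
    Next (new i) (new j) = toℕ j ≡ suc (toℕ i)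

    OldAdj : Rel SubdividedVertex 0ℓ
    OldAdj (old u) (old v) = Graph.Adj _∖_ u v
    OldAdj (old u) (new j) = ⊥
    OldAdj (new i) b       = ⊥

    SubdividedAdj : Rel SubdividedVertex 0ℓ
    SubdividedAdj a b = OldAdj a b ⊎ (Next a b ⊎ Next b a)

    private
      next? : Decidable Next
      next? (old u) (old v) = no λ ()
      next? (old u) (new j) = (u ≟ x) ×-dec (toℕ j ≟ℕ 0)
      next? (new i) (old v) = (suc (toℕ i) ≟ℕ t) ×-dec (v ≟ y)
      next? (new i) (new j) = toℕ j ≟ℕ suc (toℕ i)

      oldAdj? : Decidable OldAdj
      oldAdj? (old u) (old v) = Graph.adj? _∖_ u v
      oldAdj? (old u) (new j) = no λ ()
      oldAdj? (new i) b       = no λ ()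

      oldAdj-sym : Symmetric OldAdj
      oldAdj-sym {old u} {old v} = Graph.sym _∖_

      oldAdj-irrefl : ∀ a → ¬ OldAdj a a
      oldAdj-irrefl (old u) = Graph.irrefl _∖_ refl

      next-irrefl : ∀ a → ¬ Next a a
      next-irrefl (new i) = 1+n≢n ∘ ≡.sym

      subdividedAdj-irrefl : Irreflexive _≡_ SubdividedAdj
      subdividedAdj-irrefl {a} refl (inj₁ p)        = oldAdj-irrefl a p
      subdividedAdj-irrefl {a} refl (inj₂ (inj₁ p)) = next-irrefl a p
      subdividedAdj-irrefl {a} refl (inj₂ (inj₂ p)) = next-irrefl a p

    -- The edge e is replaced by a path with t new internal vertices, hence
    -- of length t + 1.  Only t ≥ 1 is a subdivision: for t = 0 the edge is
    -- merely deleted, as Next is then empty.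
    subdivide : Graph
    subdivide = record
      { Vertex = SubdividedVertex
      ; order  = order + t
      ; finite = ↔-sym +↔⊎ ↔-∘ (finite ⊎-↔ ↔-id (Fin t))
      ; Adj    = SubdividedAdj
      ; adj?   = λ a b → oldAdj? a b ⊎-dec (next? a b ⊎-dec next? b a)
      ; sym    = λ {a} {b} → Sum.map (oldAdj-sym {a} {b}) Sum.swap
      ; irrefl = subdividedAdj-irrefl
      }

{-# OPTIONS --safe #-}

-- Let D be an acyclic digraph.  D has no shortcut if and only if, for every
-- arc u ⟶ w, the vertices lying on a walk from u to w form a tournament along
-- reachability: u ⇝ a ⇝ b ⇝ w and a ≢ b imply a ⟶ b.  This reformulation
-- (IntervalClosed) is self-dual and speaks only of walks.
--
-- Deleting the new vertices from an oriented G_e gives one direction.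
-- Conversely, orient G ∖ e.  If y is reachable from x, direct the new path
-- from x to y: an arc u ⟶ w with u ⇝ x and y ⇝ w would force x ⟶ y in G ∖ e,
-- so no arc spans the new path.  If x is reachable from y, reverse the
-- orientation first.  If neither holds, make the first new vertex a source:
-- then the only walk along any new arc is that arc itself.
module Submission where

open import Defs
open import Data.Nat.Base as ℕ using (ℕ; zero; suc; _≤_; z≤n; s≤s)
import Data.Nat.Properties as ℕ
open import Data.Fin.Base as Fin using (Fin; zero; suc; toℕ; fromℕ; inject₁)
import Data.Fin.Properties as Fin
open import Data.Product.Base using (Σ-syntax; ∃; ∃-syntax; _×_; _,_; proj₁; proj₂)
open import Data.Sum.Base as Sum using (_⊎_; inj₁; inj₂)
open import Data.Sum.Properties using (inj₁-injective)
open import Function.Base using (_∘_; flip; id)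
open import Function.Bundles using (_⇔_; mk⇔; module Inverse; module Injection)
open import Function.Properties.Inverse using (↔⇒↣)
open import Function.Definitions using (Injective)
open import Level using (0ℓ)
open import Relation.Binary.Core using (Rel)
open import Relation.Binary.Definitions using (Decidable; tri<; tri≈; tri>)
open import Relation.Binary.Construct.Closure.ReflexiveTransitive
  using (Star; ε; _◅_; _◅◅_; reverse; return)
open import Relation.Binary.PropositionalEquality
  using (_≡_; _≢_; refl; sym; trans; cong; subst)
open import Relation.Nullary.Negation.Core using (¬_; contradiction)
open import Relation.Nullary.Decidable using (Dec; yes; no; map′; _×-dec_; decidable-stable)
import Relation.Unary as Unary

-- Walks and the vertices on them.

module _ {V : Set} {_⟶_ : Rel V 0ℓ} where

  length : ∀ {u w} → Star _⟶_ u w → ℕ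
  length ε       = 0
  length (_ ◅ p) = suc (length p)

  at : ∀ {u w} (p : Star _⟶_ u w) → Fin (suc (length p)) → V
  at {u} p       zero    = u
  at     (_ ◅ p) (suc i) = at p i

  at-last : ∀ {u w} (p : Star _⟶_ u w) → at p (fromℕ (length p)) ≡ w
  at-last ε       = refl
  at-last (_ ◅ p) = at-last p

  at-steps : ∀ {u w} (p : Star _⟶_ u w) i → at p (inject₁ i) ⟶ at p (suc i)
  at-steps (e ◅ p) zero    = e
  at-steps (_ ◅ p) (suc i) = at-steps p i

  prefix : ∀ {u w} (p : Star _⟶_ u w) j →
           Σ[ q ∈ Star _⟶_ u (at p j) ] length q ≤ length p
  prefix p       zero    = ε , z≤n
  prefix (e ◅ p) (suc j) = let q , q≤p = prefix p j in e ◅ q , s≤s q≤p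

  segment : ∀ {u w} (p : Star _⟶_ u w) {i j} → i Fin.< j →
            ∃[ c ] at p i ⟶ c × Σ[ q ∈ Star _⟶_ c (at p j) ] length q ℕ.< length p
  segment (e ◅ p) {zero}  {suc j} _ =
    let q , q≤p = prefix p j in _ , e , q , s≤s q≤p
  segment (_ ◅ p) {suc i} {suc j} (s≤s i<j) =
    let c , e , q , q<p = segment p i<j in c , e , q , ℕ.m≤n⇒m≤1+n q<p

  -- A repeated vertex cuts out of `p` an arc together with a walk back that is shorter than `p`.
  -- Forbidding only closed walks this short lets the induction in `noCycle⇒acyclic` supply the
  -- hypothesis.
  at-injective : ∀ {u w} (p : Star _⟶_ u w) →
                 (∀ {a b} → a ⟶ b → (q : Star _⟶_ b a) → ¬ length q ℕ.< length p) →
                 Injective _≡_ _≡_ (at p)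
  at-injective p acyclic = go
    where
    distinct : ∀ {i j} → i Fin.< j → at p i ≢ at p j
    distinct i<j pᵢ≡pⱼ with segment p i<j
    ... | c , e , q , q<p =
      acyclic (subst (_⟶ c) pᵢ≡pⱼ e) q q<p

    go : Injective _≡_ _≡_ (at p)
    go {i} {j} pᵢ≡pⱼ with Fin.<-cmp i j
    ... | tri< i<j _ _ = contradiction pᵢ≡pⱼ (distinct i<j)
    ... | tri≈ _ i≡j _ = i≡j
    ... | tri> _ _ j<i = contradiction (sym pᵢ≡pⱼ) (distinct j<i)

  Spanned : ∀ {u w} → Star _⟶_ u w → Set
  Spanned p = ∀ {i j} → i Fin.< j → at p i ⟶ at p j

  spanned-suffix : ∀ {u a w} (p : Star _⟶_ u a) {q : Star _⟶_ a w} →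
                   Spanned (p ◅◅ q) → Spanned q
  spanned-suffix ε       s = s
  spanned-suffix (_ ◅ p) s = spanned-suffix p (λ i<j → s (s≤s i<j))

  position : ∀ {u a w} (p : Star _⟶_ u a) (q : Star _⟶_ a w) → ∃[ i ] at (p ◅◅ q) i ≡ a
  position ε       q = zero , refl
  position (_ ◅ p) q = let i , eq = position p q in suc i , eq

  -- Induction along the walk: the first arc, followed by an arc spanning the tail, gives every
  -- longer arc from the start. Transitivity is asked of positions, as in `Shortcut`.
  transitive⇒spanned : ∀ {u w} (p : Star _⟶_ u w) → Injective _≡_ _≡_ (at p) →
                       (∀ {i j k} → i ≢ j → j ≢ k → i ≢ k →
                        at p i ⟶ at p j → at p j ⟶ at p k → at p i ⟶ at p k) →
                       Spanned p
  transitive⇒spanned ε _ _ {zero} {zero} ()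
  transitive⇒spanned (e ◅ p) inj tr = spanned
    where
    tail-spanned : Spanned p
    tail-spanned = transitive⇒spanned p (Fin.suc-injective ∘ inj)
      λ i≢j j≢k i≢k → tr (i≢j ∘ Fin.suc-injective) (j≢k ∘ Fin.suc-injective)
                         (i≢k ∘ Fin.suc-injective)

    spanned : Spanned (e ◅ p)
    spanned {zero}  {suc zero}    _ = e
    spanned {zero}  {suc (suc j)} _ =
      tr {zero} {suc zero} {suc (suc j)} (λ ()) (λ ()) (λ ()) e (tail-spanned (s≤s z≤n))
    spanned {suc i} {suc j} (s≤s i<j) = tail-spanned i<j

-- Interval-closed digraphs and shortcuts.

module _ {V : Set} (_⟶_ : Rel V 0ℓ) where

  record IntervalClosed : Set where
    field
      acyclic  : ∀ {a b} → a ⟶ b → ¬ Star _⟶_ b a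
      interval : ∀ {u a b w} → u ⟶ w → Star _⟶_ u a → Star _⟶_ a b → Star _⟶_ b w →
                 a ≢ b → a ⟶ b

module _ {V : Set} {_⟶_ : Rel V 0ℓ} where

  acyclic⇒antisym : (∀ {a b} → a ⟶ b → ¬ Star _⟶_ b a) →
                    ∀ {a b} → Star _⟶_ a b → Star _⟶_ b a → a ≡ b
  acyclic⇒antisym acyclic ε       q = refl
  acyclic⇒antisym acyclic (e ◅ p) q = contradiction (p ◅◅ q) (acyclic e)

  at-path : ∀ {u w} (p : Star _⟶_ u w) →
            (∀ {a b} → a ⟶ b → (q : Star _⟶_ b a) → ¬ length q ℕ.< length p) →
            IsDirectedPath _⟶_ (at p)
  at-path p acyclic = record { distinct = at-injective p acyclic ; steps = at-steps p }

  -- A shortest closed walk is a directed cycle.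
  noCycle⇒acyclic : ¬ DirectedCycle _⟶_ → ∀ {a b} → a ⟶ b → ¬ Star _⟶_ b a
  noCycle⇒acyclic noCycle {a} {b} e p = bounded (suc (length p)) e p ℕ.≤-refl
    where
    bounded : ∀ n {a b} → a ⟶ b → (p : Star _⟶_ b a) → ¬ length p ℕ.< n
    bounded (suc n) e p (s≤s p≤n) = noCycle record
      { v      = at p
      ; path   = at-path p λ e q q<p → bounded n e q (ℕ.<-≤-trans q<p p≤n)
      ; closes = subst (_⟶ _) (sym (at-last p)) e
      }

  -- Acyclicity makes the walk a path. With three or more arcs it has the four vertices that a
  -- shortcut requires, so a missing arc would produce one; with fewer arcs, the walk's own arcs and
  -- `uw` account for all pairs.
  noShortcut⇒spanned : Decidable _⟶_ → (∀ {a b} → a ⟶ b → ¬ Star _⟶_ b a) →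
                       ¬ Shortcut _⟶_ →
                       ∀ {u w} → u ⟶ w → (p : Star _⟶_ u w) → Spanned p
  noShortcut⇒spanned arc? acyclic noShortcut uw (e ◅ ε) {zero} {suc zero} _ = e
  noShortcut⇒spanned arc? acyclic noShortcut uw (e ◅ f ◅ ε) {zero} {suc zero} _ = e
  noShortcut⇒spanned arc? acyclic noShortcut uw (e ◅ f ◅ ε) {zero} {suc (suc zero)} _ = uw
  noShortcut⇒spanned arc? acyclic noShortcut uw (e ◅ f ◅ ε) {suc zero} {suc (suc zero)} _ = f
  noShortcut⇒spanned arc? acyclic noShortcut uw (e ◅ f ◅ ε) {suc zero} {suc zero} (s≤s ())
  noShortcut⇒spanned arc? acyclic noShortcut uw (e ◅ f ◅ ε) {suc (suc zero)} {suc (suc zero)}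
                     (s≤s (s≤s ()))
  noShortcut⇒spanned arc? acyclic noShortcut uw p@(_ ◅ _ ◅ _ ◅ _) {i} {j} i<j =
    -- The absence of shortcuts yields only the double negation of the arc.
    decidable-stable (arc? (at p i) (at p j)) λ ¬pᵢ⟶pⱼ → noShortcut record
      { v             = at p
      ; path          = path
      ; shortcutting  = subst (_ ⟶_) (sym (at-last p)) uw
      ; nontransitive = λ tr →
          ¬pᵢ⟶pⱼ (transitive⇒spanned p (IsDirectedPath.distinct path) tr i<j)
      }
    where path = at-path p λ e q _ → acyclic e q

  semiTransitive⇒intervalClosed : Decidable _⟶_ → ¬ DirectedCycle _⟶_ → ¬ Shortcut _⟶_ →
                                  IntervalClosed _⟶_
  semiTransitive⇒intervalClosed arc? noCycle noShortcut = record
    { acyclic = acyclic ; interval = interval }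
    where
    acyclic = noCycle⇒acyclic noCycle

    interval : ∀ {u a b w} → u ⟶ w → Star _⟶_ u a → Star _⟶_ a b → Star _⟶_ b w →
               a ≢ b → a ⟶ b
    interval uw p ε       r a≢a = contradiction refl a≢a
    -- As `a` and `b` differ, the middle walk is nonempty. Once `p` is dropped, `a` stands at
    -- position zero and `b` at a successor position.
    interval uw p (e ◅ q) r _   = let i , eq = position q r in
      subst (_ ⟶_) eq
        (spanned-suffix p {e ◅ q ◅◅ r}
          (noShortcut⇒spanned arc? acyclic noShortcut uw (p ◅◅ e ◅ q ◅◅ r))
          {zero} {suc i} (s≤s z≤n))

  walk : ∀ {k} (v : Fin (suc k) → V) → (∀ i → v (inject₁ i) ⟶ v (suc i)) →
         ∀ {i j} → i Fin.≤ j → Star _⟶_ (v i) (v j)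
  walk         v steps {zero}  {zero}  _         = ε
  walk {suc k} v steps {zero}  {suc j} _         =
    steps zero ◅ walk (v ∘ suc) (steps ∘ suc) {zero} {j} z≤n
  walk {suc k} v steps {suc i} {suc j} (s≤s i≤j) = walk (v ∘ suc) (steps ∘ suc) i≤j

  intervalClosed⇒noCycle : IntervalClosed _⟶_ → ¬ DirectedCycle _⟶_
  intervalClosed⇒noCycle closed c = acyclic closes (walk v steps {j = fromℕ _} z≤n)
    where
    open IntervalClosed closed
    open DirectedCycle c
    open IsDirectedPath path

  -- All vertices of a shortcut lie on its path, hence in the interval of the shortcutting arc, so a
  -- later one receives an arc from every earlier one. Two arcs that lead backwards along the path
  -- would close a cycle.
  intervalClosed⇒noShortcut : IntervalClosed _⟶_ → ¬ Shortcut _⟶_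
  intervalClosed⇒noShortcut closed s = nontransitive transitive
    where
    open IntervalClosed closed
    open Shortcut s
    open IsDirectedPath path

    transitive : TransitiveDigraph λ i j → v i ⟶ v j
    transitive {i} {j} {k} _ _ i≢k ij jk with ℕ.≤-total (toℕ i) (toℕ k)
    ... | inj₁ i≤k = interval shortcutting (walk v steps z≤n) (walk v steps i≤k)
                       (walk v steps (Fin.≤fromℕ k)) (i≢k ∘ distinct)
    ... | inj₂ k≤i = contradiction (return jk ◅◅ walk v steps k≤i) (acyclic ij)

  reverseClosed : IntervalClosed _⟶_ → IntervalClosed (flip _⟶_)
  reverseClosed closed = record
    { acyclic  = λ e p → acyclic e (reverse id p)
    ; interval = λ uw p q r a≢b →
        interval uw (reverse id r) (reverse id q) (reverse id p) (a≢b ∘ sym)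
    }
    where open IntervalClosed closed

-- Deciding arcs and reachability.

module _ {G : Graph} (φ : Orientation G) where
  open Graph G hiding (sym)
  open Orientation φ

  -- Adjacency is decidable, `orient` then exhibits one direction, and `asym` refutes the other.
  arc? : Decidable Arc
  arc? u v with adj? u v
  ... | no ¬uv = no (¬uv ∘ arc⇒adj)
  ... | yes uv with orient uv
  ...   | inj₁ u⟶v = yes u⟶v
  ...   | inj₂ v⟶u = no (asym v⟶u)

  intervalClosed : SemiTransitive φ → IntervalClosed Arc
  intervalClosed (noCycle , noShortcut) =
    semiTransitive⇒intervalClosed arc? noCycle noShortcut

  private
    open Inverse finite using (to; from; strictlyInverseʳ)

    any? : {P : Vertex → Set} → Unary.Decidable P → Dec (∃ P)
    any? {P} P? = map′ (λ (i , p) → from i , p)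
                       (λ (v , p) → to v , subst P (sym (strictlyInverseʳ v)) p)
                       (Fin.any? (P? ∘ from))

  boundedWalk? : ∀ n u w → Dec (Σ[ p ∈ Star Arc u w ] length p ≤ n)
  boundedWalk? n u w with u ≟ w
  boundedWalk? n       u u | yes refl = yes (ε , z≤n)
  boundedWalk? zero    u w | no u≢w   =
    no λ { (ε , _) → u≢w refl ; (_ ◅ _ , ()) }
  boundedWalk? (suc n) u w | no u≢w   =
    map′ (λ { (v , e , p , p≤n) → e ◅ p , s≤s p≤n })
         (λ { (ε , _) → contradiction refl u≢w ; (e ◅ p , s≤s p≤n) → _ , e , p , p≤n })
         (any? λ v → arc? u v ×-dec boundedWalk? n v w)

  -- In an acyclic digraph no walk repeats a vertex, so its length is below `order` and a bounded
  -- search is complete. This makes the case distinction in `extend` constructive.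
  reachable? : (∀ {a b} → Arc a b → ¬ Star Arc b a) → Decidable (Star Arc)
  reachable? acyclic u w =
    map′ proj₁ (λ p → p , ℕ.≤-trans (ℕ.n≤1+n _) (length<order p)) (boundedWalk? order u w)
    where
    length<order : ∀ {u w} (p : Star Arc u w) → suc (length p) ≤ order
    length<order p = Fin.injective⇒≤
      (at-injective p (λ e q _ → acyclic e q) ∘ Injection.injective (↔⇒↣ finite))

  reverseOrientation : Orientation G
  reverseOrientation = record
    { Arc     = flip Arc
    ; arc⇒adj = Graph.sym G ∘ arc⇒adj
    ; orient  = Sum.swap ∘ orient
    ; asym    = asym
    }

-- From the subdivision to the graph with the edge deleted.

restrict : (G : Graph) (e : Edge G) (t : ℕ) →
           SemiTransitivelyOrientable (subdivide G e t) → SemiTransitivelyOrientable (G ∖ e)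
restrict G e t (ψ , noCycle , noShortcut) = record
  { Arc     = λ u v → Arc (old u) (old v)
  ; arc⇒adj = oldAdj ∘ arc⇒adj
  ; orient  = orient ∘ inj₁
  ; asym    = asym
  } ,
  (λ c → let open DirectedCycle c in
     noCycle record { v = old ∘ v ; path = embed path ; closes = closes }) ,
  (λ s → let open Shortcut s in
     noShortcut record { v = old ∘ v ; path = embed path ; shortcutting = shortcutting
                       ; nontransitive = nontransitive })
  where
  open Orientation ψ

  -- `Next` relates no two old vertices, so these induce exactly the graph with `e` deleted; cycles
  -- and shortcuts of the restriction are thus already present in `ψ`.
  oldAdj : ∀ {u v} → SubdividedAdj G e t (old u) (old v) → Graph.Adj (G ∖ e) u v
  oldAdj (inj₁ uv) = uv
  oldAdj (inj₂ (inj₁ ()))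
  oldAdj (inj₂ (inj₂ ()))

  embed : ∀ {k} {v : Fin (suc k) → Graph.Vertex G} →
          IsDirectedPath (λ u v → Arc (old u) (old v)) v → IsDirectedPath Arc (old ∘ v)
  embed path = record { distinct = distinct ∘ inj₁-injective ; steps = steps }
    where open IsDirectedPath path

-- From the graph with the edge deleted to the subdivision.

Covered : {V : Set} → Rel V 0ℓ → Rel V 0ℓ
Covered _⟶_ u w = ∀ {a} → Star _⟶_ u a → Star _⟶_ a w → a ≡ u ⊎ a ≡ w

-- Only the two ends of the arc are available for `a` and `b`: in one order they are joined by the
-- arc itself, in the other the walk between them closes a cycle.
covered⇒interval : {V : Set} {_⟶_ : Rel V 0ℓ} → (∀ {a b} → a ⟶ b → ¬ Star _⟶_ b a) →
                   ∀ {u a b w} → u ⟶ w → Covered _⟶_ u w →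
                   Star _⟶_ u a → Star _⟶_ a b → Star _⟶_ b w → a ≢ b → a ⟶ b
covered⇒interval acyclic uw covered p q r a≢b
  with covered p (q ◅◅ r) | covered (p ◅◅ q) r
... | inj₁ refl | inj₁ refl = contradiction refl a≢b
... | inj₁ refl | inj₂ refl = uw
... | inj₂ refl | inj₁ refl = contradiction q (acyclic uw)
... | inj₂ refl | inj₂ refl = contradiction refl a≢b

module _ (G : Graph) (e : Edge G) (t : ℕ) where
  open Edge e using (x; y)

  private
    x≢y : x ≢ y
    x≢y x≡y = Graph.irrefl G x≡y (Edge.adj e)

    orientable : (_⟶_ : Rel (SubdividedVertex G e t) 0ℓ) → IntervalClosed _⟶_ →
                 (∀ {a b} → a ⟶ b → SubdividedAdj G e t a b) →
                 (∀ {u v} → Graph.Adj (G ∖ e) u v → old u ⟶ old v ⊎ old v ⟶ old u) →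
                 (∀ a b → Next G e t a b → a ⟶ b ⊎ b ⟶ a) →
                 SemiTransitivelyOrientable (subdivide G e t)
    orientable _⟶_ closed arc⇒adj orientOld orientNext = record
      { Arc     = _⟶_
      ; arc⇒adj = arc⇒adj
      ; orient  = orient _ _
      ; asym    = λ ab ba → IntervalClosed.acyclic closed ab (return ba)
      } , intervalClosed⇒noCycle closed , intervalClosed⇒noShortcut closed
      where
      orient : ∀ a b → SubdividedAdj G e t a b → a ⟶ b ⊎ b ⟶ a
      orient (old u) (old v) (inj₁ uv)        = orientOld uv
      orient a       b       (inj₂ (inj₁ ab)) = orientNext a b ab
      orient a       b       (inj₂ (inj₂ ba)) = Sum.swap (orientNext b a ba)

  module _ (φ : Orientation (G ∖ e)) (closed : IntervalClosed (Orientation.Arc φ)) where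
    open Orientation φ
    open IntervalClosed closed

    private
      antisym = acyclic⇒antisym acyclic

      ¬x⟶y : ¬ Arc x y
      ¬x⟶y x⟶y = proj₂ (arc⇒adj x⟶y) (inj₁ (refl , refl))

    -- The new path directed from x to y.

    data ThroughArc : Rel (SubdividedVertex G e t) 0ℓ where
      base  : ∀ {u v} → Arc u v → ThroughArc (old u) (old v)
      enter : ∀ {i} → toℕ i ≡ 0 → ThroughArc (old x) (new i)
      along : ∀ {i j} → toℕ j ≡ suc (toℕ i) → ThroughArc (new i) (new j)
      leave : ∀ {i} → suc (toℕ i) ≡ t → ThroughArc (new i) (old y)

    module Through (x⇝y : Star Arc x y) where

      -- Contract the new path to x, and record by height the position on it:
      -- every arc either advances the contraction or increases the height.
      contract : SubdividedVertex G e t → Graph.Vertex G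
      contract (old u) = u
      contract (new _) = x

      height : SubdividedVertex G e t → ℕ
      height (old _) = 0
      height (new i) = suc (toℕ i)

      contractWalk : ∀ {a b} → Star ThroughArc a b → Star Arc (contract a) (contract b)
      contractWalk ε             = ε
      contractWalk (base uv ◅ p) = uv ◅ contractWalk p
      contractWalk (enter _ ◅ p) = contractWalk p
      contractWalk (along _ ◅ p) = contractWalk p
      contractWalk (leave _ ◅ p) = x⇝y ◅◅ contractWalk p

      -- The walk back says that the arc makes no progress in the contraction. This excludes `base`,
      -- by acyclicity, and `leave`, which would identify `x` with `y`; the other arcs climb.
      step-height : ∀ {a b} → ThroughArc a b → Star Arc (contract b) (contract a) →
                    height a ℕ.< height b
      step-height (base uv)     p = contradiction p (acyclic uv)
      step-height (enter _)     p = s≤s z≤n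
      step-height (along j≡1+i) p = s≤s (ℕ.≤-reflexive (sym j≡1+i))
      step-height (leave _)     p = contradiction (antisym x⇝y p) x≢y

      walk-height : ∀ {a b} → Star ThroughArc a b → Star Arc (contract b) (contract a) →
                    height a ≤ height b
      walk-height ε       q = ℕ.≤-refl
      walk-height (e ◅ p) q = ℕ.≤-trans
        (ℕ.<⇒≤ (step-height e (contractWalk p ◅◅ q)))
        -- The contraction of the whole walk is closed by `q`, so rotating this closed walk supplies
        -- a return for each of its arcs.
        (walk-height p (q ◅◅ contractWalk (return e)))

      through-acyclic : ∀ {a b} → ThroughArc a b → ¬ Star ThroughArc b a
      through-acyclic e p = ℕ.<⇒≱ (step-height e (contractWalk p))
                                  (walk-height p (contractWalk (return e)))

      exit : ∀ {i w} → Star ThroughArc (new i) (old w) → Star Arc y w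
      exit (along _ ◅ p) = exit p
      exit (leave _ ◅ p) = contractWalk p

      -- Every new vertex contracts to `x`, so the first walk gives one from `u` to `x`; the second
      -- can leave the new path only at `y`.
      unspanned : ∀ {u i w} → Arc u w → Star ThroughArc (old u) (new i) →
                  ¬ Star ThroughArc (new i) (old w)
      unspanned uw p q = ¬x⟶y (interval uw (contractWalk p) x⇝y (exit q) x≢y)

      -- Both ends contract to `x`: an old vertex between them equals `x` by antisymmetry, and a new
      -- one is at most as high as the first.
      enter-covered : ∀ {i} → toℕ i ≡ 0 → Covered ThroughArc (old x) (new i)
      enter-covered i≡0 {old a} p q = inj₁ (cong old (antisym (contractWalk q) (contractWalk p)))
      enter-covered i≡0 {new k} p q = inj₂ (cong new (Fin.toℕ-injective (trans
        (ℕ.n≤0⇒n≡0 (ℕ.≤-trans (ℕ.s≤s⁻¹ (walk-height q ε)) (ℕ.≤-reflexive i≡0)))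
        (sym i≡0))))

      -- An old vertex has height zero, too low to follow `new i` on a walk that returns to the new
      -- path; between consecutive heights there is no further new vertex.
      along-covered : ∀ {i j} → toℕ j ≡ suc (toℕ i) → Covered ThroughArc (new i) (new j)
      along-covered j≡1+i {old a} p q = contradiction (walk-height p (contractWalk q)) λ ()
      along-covered j≡1+i {new k} p q
        with ℕ.m≤n⇒m<n∨m≡n (ℕ.s≤s⁻¹ (walk-height p ε))
      ... | inj₂ i≡k = inj₁ (cong new (Fin.toℕ-injective (sym i≡k)))
      ... | inj₁ i<k = inj₂ (cong new (Fin.toℕ-injective (ℕ.≤-antisym
        (ℕ.s≤s⁻¹ (walk-height q ε)) (ℕ.≤-trans (ℕ.≤-reflexive j≡1+i) i<k))))

      -- Old vertices reached from `new i` lie beyond `y`, and `new i` is the last new vertex.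
      leave-covered : ∀ {i} → suc (toℕ i) ≡ t → Covered ThroughArc (new i) (old y)
      leave-covered 1+i≡t {old a} p q = inj₂ (cong old (antisym (contractWalk q) (exit p)))
      leave-covered 1+i≡t {new k} p q = inj₁ (cong new (Fin.toℕ-injective (ℕ.≤-antisym
        (ℕ.s≤s⁻¹ (ℕ.≤-trans (Fin.toℕ<n k) (ℕ.≤-reflexive (sym 1+i≡t))))
        (ℕ.s≤s⁻¹ (walk-height p ε)))))

      through-interval : ∀ {u a b w} → ThroughArc u w → Star ThroughArc u a →
                         Star ThroughArc a b → Star ThroughArc b w → a ≢ b → ThroughArc a b
      through-interval {a = old a} {old b} (base uw) p q r a≢b =
        base (interval uw (contractWalk p) (contractWalk q) (contractWalk r) (a≢b ∘ cong old))
      through-interval {a = old a} {new i} (base uw) p q r _ =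
        contradiction r (unspanned uw (p ◅◅ q))
      through-interval {a = new i} (base uw) p q r _ =
        contradiction (q ◅◅ r) (unspanned uw p)
      through-interval (enter i≡0) =
        covered⇒interval through-acyclic (enter i≡0) (enter-covered i≡0)
      through-interval (along j≡1+i) =
        covered⇒interval through-acyclic (along j≡1+i) (along-covered j≡1+i)
      through-interval (leave 1+i≡t) =
        covered⇒interval through-acyclic (leave 1+i≡t) (leave-covered 1+i≡t)

      through-orientable : SemiTransitivelyOrientable (subdivide G e t)
      through-orientable = orientable ThroughArc
        (record { acyclic = through-acyclic ; interval = through-interval })
        (λ { (base uv)     → inj₁ (arc⇒adj uv)
           ; (enter i≡0)   → inj₂ (inj₁ (refl , i≡0))
           ; (along j≡1+i) → inj₂ (inj₁ j≡1+i)
           ; (leave 1+i≡t) → inj₂ (inj₁ (1+i≡t , refl)) })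
        (Sum.map base base ∘ orient)
        (λ { (old _) (new _) (refl , i≡0)   → inj₁ (enter i≡0)
           ; (new _) (new _) j≡1+i          → inj₁ (along j≡1+i)
           ; (new _) (old _) (1+i≡t , refl) → inj₁ (leave 1+i≡t) })

    -- The first new vertex as a source.

    data SourceArc : Rel (SubdividedVertex G e t) 0ℓ where
      base  : ∀ {u v} → Arc u v → SourceArc (old u) (old v)
      back  : ∀ {i} → toℕ i ≡ 0 → SourceArc (new i) (old x)
      along : ∀ {i j} → toℕ j ≡ suc (toℕ i) → SourceArc (new i) (new j)
      leave : ∀ {i} → suc (toℕ i) ≡ t → SourceArc (new i) (old y)

    module Source (¬x⇝y : ¬ Star Arc x y) (¬y⇝x : ¬ Star Arc y x) where

      -- No arc leads from an old vertex to a new one, so a walk that leaves the new path continues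
      -- in `φ`; no contraction is called for.
      no-entry : ∀ {u j} → ¬ Star SourceArc (old u) (new j)
      no-entry (base _ ◅ p) = no-entry p

      baseWalk : ∀ {u w} → Star SourceArc (old u) (old w) → Star Arc u w
      baseWalk ε             = ε
      baseWalk (base uv ◅ p) = uv ◅ baseWalk p

      along-≤ : ∀ {i j} → Star SourceArc (new i) (new j) → toℕ i ≤ toℕ j
      along-≤ ε                 = ℕ.≤-refl
      along-≤ (back _ ◅ p)      = contradiction p no-entry
      along-≤ (along k≡1+i ◅ p) =
        ℕ.<⇒≤ (ℕ.≤-trans (ℕ.≤-reflexive (sym k≡1+i)) (along-≤ p))
      along-≤ (leave _ ◅ p)     = contradiction p no-entry

      exit : ∀ {i w} → Star SourceArc (new i) (old w) →
             (toℕ i ≡ 0 × Star Arc x w) ⊎ Star Arc y w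
      exit (back i≡0 ◅ p)    = inj₁ (i≡0 , baseWalk p)
      exit (leave _ ◅ p)     = inj₂ (baseWalk p)
      exit (along k≡1+i ◅ p) with exit p
      -- Only the first new vertex has an arc to `x`, and `along` never leads to it.
      ... | inj₁ (k≡0 , _) = contradiction (trans (sym k≡1+i) k≡0) λ ()
      ... | inj₂ q         = inj₂ q

      source-acyclic : ∀ {a b} → SourceArc a b → ¬ Star SourceArc b a
      source-acyclic (base uv)     p = acyclic uv (baseWalk p)
      source-acyclic (back _)      p = no-entry p
      source-acyclic (along j≡1+i) p = ℕ.<⇒≱ (ℕ.≤-reflexive (sym j≡1+i)) (along-≤ p)
      source-acyclic (leave _)     p = no-entry p

      -- A walk that avoids the arc itself would leave the new path at `y` and so reach `x` from
      -- `y`.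
      back-covered : ∀ {i} → toℕ i ≡ 0 → Covered SourceArc (new i) (old x)
      back-covered i≡0 {old a} p q with exit p
      ... | inj₁ (_ , x⇝a) = inj₂ (cong old (antisym (baseWalk q) x⇝a))
      ... | inj₂ y⇝a       = contradiction (y⇝a ◅◅ baseWalk q) ¬y⇝x
      back-covered i≡0 {new k} p q with exit q
      ... | inj₁ (k≡0 , _) = inj₁ (cong new (Fin.toℕ-injective (trans k≡0 (sym i≡0))))
      ... | inj₂ y⇝x       = contradiction y⇝x ¬y⇝x

      along-covered : ∀ {i j} → toℕ j ≡ suc (toℕ i) → Covered SourceArc (new i) (new j)
      along-covered j≡1+i {old a} p q = contradiction q no-entry
      along-covered j≡1+i {new k} p q with ℕ.m≤n⇒m<n∨m≡n (along-≤ p)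
      ... | inj₂ i≡k = inj₁ (cong new (Fin.toℕ-injective (sym i≡k)))
      ... | inj₁ i<k = inj₂ (cong new (Fin.toℕ-injective (ℕ.≤-antisym
        (along-≤ q) (ℕ.≤-trans (ℕ.≤-reflexive j≡1+i) i<k))))

      -- A detour through `x` would start at a vertex both first and last on the new path, and would
      -- reach `y` from `x`.
      leave-covered : ∀ {i} → suc (toℕ i) ≡ t → Covered SourceArc (new i) (old y)
      leave-covered 1+i≡t {old a} p q with exit p
      ... | inj₁ (_ , x⇝a) = contradiction (x⇝a ◅◅ baseWalk q) ¬x⇝y
      ... | inj₂ y⇝a       = inj₂ (cong old (antisym (baseWalk q) y⇝a))
      leave-covered 1+i≡t {new k} p q = inj₁ (cong new (Fin.toℕ-injective (ℕ.≤-antisym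
        (ℕ.s≤s⁻¹ (ℕ.≤-trans (Fin.toℕ<n k) (ℕ.≤-reflexive (sym 1+i≡t)))) (along-≤ p))))

      source-interval : ∀ {u a b w} → SourceArc u w → Star SourceArc u a →
                        Star SourceArc a b → Star SourceArc b w → a ≢ b → SourceArc a b
      source-interval {a = old a} {old b} (base uw) p q r a≢b =
        base (interval uw (baseWalk p) (baseWalk q) (baseWalk r) (a≢b ∘ cong old))
      source-interval {a = old a} {new i} (base uw) p q r _ = contradiction q no-entry
      source-interval {a = new i}         (base uw) p q r _ = contradiction p no-entry
      source-interval (back i≡0) =
        covered⇒interval source-acyclic (back i≡0) (back-covered i≡0)
      source-interval (along j≡1+i) =
        covered⇒interval source-acyclic (along j≡1+i) (along-covered j≡1+i)
      source-interval (leave 1+i≡t) =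
        covered⇒interval source-acyclic (leave 1+i≡t) (leave-covered 1+i≡t)

      source-orientable : SemiTransitivelyOrientable (subdivide G e t)
      source-orientable = orientable SourceArc
        (record { acyclic = source-acyclic ; interval = source-interval })
        (λ { (base uv)     → inj₁ (arc⇒adj uv)
           ; (back i≡0)    → inj₂ (inj₂ (refl , i≡0))
           ; (along j≡1+i) → inj₂ (inj₁ j≡1+i)
           ; (leave 1+i≡t) → inj₂ (inj₁ (1+i≡t , refl)) })
        (Sum.map base base ∘ orient)
        (λ { (old _) (new _) (refl , i≡0)   → inj₂ (back i≡0)
           ; (new _) (new _) j≡1+i          → inj₁ (along j≡1+i)
           ; (new _) (old _) (1+i≡t , refl) → inj₁ (leave 1+i≡t) })

  -- Case distinction on reachability between the ends.

  extend : SemiTransitivelyOrientable (G ∖ e) → SemiTransitivelyOrientable (subdivide G e t)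
  extend (φ , φ-semiTransitive) = case-reachable (reach x y) (reach y x)
    where
    open Orientation φ
    closed = intervalClosed φ φ-semiTransitive
    reach  = reachable? φ (IntervalClosed.acyclic closed)

    case-reachable : Dec (Star Arc x y) → Dec (Star Arc y x) →
                     SemiTransitivelyOrientable (subdivide G e t)
    case-reachable (yes x⇝y) _         = Through.through-orientable φ closed x⇝y
    case-reachable (no _)    (yes y⇝x) =
      -- Reversing all arcs, rather than exchanging the ends of `e`, keeps the indexing of the new
      -- path.
      Through.through-orientable (reverseOrientation φ) (reverseClosed closed) (reverse id y⇝x)
    case-reachable (no ¬x⇝y) (no ¬y⇝x) = Source.source-orientable φ closed ¬x⇝y ¬y⇝x

theorem1p11 : (G : Graph) (e : Edge G) (t : ℕ) → 1 ≤ t →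
    SemiTransitivelyOrientable (subdivide G e t) ⇔ SemiTransitivelyOrientable (G ∖ e)
theorem1p11 G e t _ = mk⇔ (restrict G e t) (extend G e t)
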